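{- Let $C_n(a,b)$ be a connected $2$-regular circulant digraph (so $\gcd(n,a,b)=1$). Let $l\ge 1$ and $0\le k\le l$ be integers, and suppose $la+k(b-a)=\omega n$ for some integer $\omega$. Then the number of primitive periodic orbits of $C_n(a,b)$ of length $l$ with $b$-count $k$ is $$|\mathcal{P}_{l,k}(C_n(a,b))|=\frac{n}{l}\sum_{m\mid \gcd(l,k,\omega)}\mu(m)\binom{l/m}{k/m},$$ where $\mu$ is the Möbius function.
   Context: Let $n\ge 2$ and $0<a<b<n$ be integers. The directed circulant graph $C_n(a,b)$ has vertex set $\mathbb{Z}_n$ and directed bonds $(v,v+a)$ and $(v,v+b)$ for each $v\in\mathbb{Z}_n$ (addition mod $n$); the bond $(v,v+s)$ has step size $s\in\{a,b\}$. It is (strongly) connected iff $\gcd(n,a,b)=1$. A path of length $l$ is a sequence of bonds $(e_1,\dots,e_l)$ where the terminus of $e_j$ is the origin of $e_{j+1}$; its $b$-count is the number of bonds of step size $b$ in it; its step sequence is the sequence of step sizes. A circuit is a path whose last terminus equals its first origin; a path of length $l$ and $b$-count $k$ is a circuit iff $n$ divides its transit distance $(l-k)a+kb$, and the winding number is the transit distance divided by $n$. A periodic orbit is an equivalence class of circuits under cyclic rotation $\sigma(e_1,\dots,e_l)=(e_2,\dots,e_l,e_1)$; length, $b$-count and winding number are well defined on orbits. For a circuit $c$, $c^r$ denotes the concatenation of $r$ copies of $c$. A periodic orbit $p$ is primitive if there is no circuit $c_0$ and integer $r>1$ with $p=[c_0^r]$. $\mathcal{P}_{l,k}(C_n(a,b))$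 denotes the set of primitive periodic orbits of length $l$ and $b$-count $k$. -}

module Defs where

open import Data.Bool.Base using (if_then_else_)
open import Data.Empty using (⊥)
open import Data.Fin.Base using (Fin; toℕ)
open import Data.Integer.Base as ℤ using (ℤ)
open import Data.List.Base using (List; []; _∷_; _∷ʳ_; concat; filter; foldr; length; map; replicate; upTo)
open import Data.List.Relation.Unary.Linked using (Linked)
open import Data.List.Relation.Unary.Unique.DecPropositional using (unique?)
open import Data.Nat.Base using (ℕ; suc; _+_; _<_; NonZero)
open import Data.Nat.Divisibility using (_∣?_)
open import Data.Nat.DivMod using (_mod_)
open import Data.Nat.Primality.Factorisation using (factorise; factors)
open import Data.Nat.Properties using (_≟_)
open import Data.Product.Base using (_×_; ∃-syntax)
open import Function.Bundles using (Bijection)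
open import Level using (0ℓ)
open import Relation.Binary.Bundles using (Setoid)
open import Relation.Binary.Construct.Closure.Equivalence as EqClosure using (EqClosure)
open import Relation.Binary.Construct.Closure.ReflexiveTransitive using (Star)
open import Relation.Binary.Construct.On as On using ()
open import Relation.Binary.PropositionalEquality.Core using (_≡_)
open import Relation.Binary.PropositionalEquality.Properties using (setoid)
open import Relation.Nullary.Decidable.Core using (does)
open import Relation.Nullary.Negation.Core using (¬_)

μ : (m : ℕ) .{{_ : NonZero m}} → ℤ
μ m = if does (unique? _≟_ primes) then ℤ.-1ℤ ℤ.^ length primes else ℤ.0ℤ
  where
  -- prime factors of m, listed with multiplicity
  primes : List ℕ
  primes = factors (factorise m)

-- The sum of f m over the positive divisors m of g, for g > 0
-- (the candidates for m are 1, …, g).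
divisorSum : ℕ → ((m : ℕ) .{{_ : NonZero m}} → ℤ) → ℤ
divisorSum g f =
  foldr ℤ._+_ ℤ.0ℤ (map (λ i → f (suc i)) (filter (λ i → suc i ∣? g) (upTo g)))

-- The number of equivalence classes of S is N.
HasCardinality : Setoid 0ℓ 0ℓ → ℕ → Set
HasCardinality S N = Bijection (setoid (Fin N)) S

module CirculantDigraph (n a b : ℕ) .{{_ : NonZero n}} where

  Vertex : Set
  Vertex = Fin n

  data Step : Set where
    a-step b-step : Step

  size : Step → ℕ
  size a-step = a
  size b-step = b

  -- A bond (v , v + s) is recorded by v and by which of a, b the step size s
  -- is; for 0 < a < b < n this determines, and is determined by, its endpoints.
  record Bond : Set where
    constructor bond
    field
      origin : Vertex
      step   : Step

    terminus : Vertex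
    terminus = (toℕ origin + size step) mod n

  open Bond public

  Adjacent : Vertex → Vertex → Set
  Adjacent u v = ∃[ e ] (origin e ≡ u × terminus e ≡ v)

  StronglyConnected : Set
  StronglyConnected = ∀ u v → Star Adjacent u v

  IsPath : List Bond → Set
  IsPath = Linked (λ e e′ → terminus e ≡ origin e′)

  bCount : List Bond → ℕ
  bCount []       = 0
  bCount (e ∷ es) with step e
  ... | a-step = bCount es
  ... | b-step = suc (bCount es)

  lastBond : Bond → List Bond → Bond
  lastBond e []        = e
  lastBond e (e′ ∷ es) = lastBond e′ es

  IsCircuit : List Bond → Set
  IsCircuit []       = ⊥
  IsCircuit (e ∷ es) = IsPath (e ∷ es) × terminus (lastBond e es) ≡ origin e

  σ : List Bond → List Bond
  σ []       = []
  σ (e ∷ es) = es ∷ʳ e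

  -- The equivalence relation generated by cyclic rotation; its classes of
  -- circuits are the periodic orbits.
  _∼_ : List Bond → List Bond → Set
  _∼_ = EqClosure (λ c c′ → σ c ≡ c′)

  _^^_ : List Bond → ℕ → List Bond
  c ^^ r = concat (replicate r c)

  IsPrimitive : List Bond → Set
  IsPrimitive c = ¬ (∃[ c₀ ] ∃[ r ] (IsCircuit c₀ × 1 < r × c ∼ (c₀ ^^ r)))

  record PrimitiveCircuit (l k : ℕ) : Set where
    field
      bonds       : List Bond
      isCircuit   : IsCircuit bonds
      length≡     : length bonds ≡ l
      bCount≡     : bCount bonds ≡ k
      isPrimitive : IsPrimitive bonds

  -- The set of primitive periodic orbits: its elements are the classes of this
  -- setoid. Two circuits are equal iff their bond sequences are rotations of
  -- each other; the proof components are disregarded.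
  𝒫 : (l k : ℕ) → Setoid 0ℓ 0ℓ
  𝒫 l k = On.setoid (EqClosure.setoid (λ c c′ → σ c ≡ c′))
                    (PrimitiveCircuit.bonds {l} {k})

{-# OPTIONS --safe #-}
module Submission where

{- A circuit c of length l has σ^(l/m) c = c exactly when m divides its exponent e, the
   largest number such that c is an e-th power.  Circuits of type (l, k, ω) fixed by
   σ^(l/m) are the m-th powers of the circuits of type (l/m, k/m, ω/m), so there are
   n · C(l/m, k/m) of them when m ∣ gcd(l, k, ω) and none otherwise.  Hence n times the
   Möbius sum equals the sum over all circuits c of Σ_{m ∣ e(c)} μ(m), which counts the
   circuits with e(c) = 1, the primitive ones; each primitive orbit contains l of these. -}

open import Defs
open import Data.Bool.Base using (if_then_else_; true; false)
open import Data.Fin.Base using (Fin; zero; suc; toℕ)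
import Data.Fin.Properties as Fin
open import Data.Integer.Base as ℤ using (ℤ; +_; ∣_∣; 0ℤ; 1ℤ; -1ℤ)
import Data.Integer.Properties as ℤ
import Data.Integer.Tactic.RingSolver as ℤ-Solver
open import Data.List.Base
  using (List; []; _∷_; [_]; _++_; _∷ʳ_; allFin; cartesianProduct; concat; deduplicate;
         drop; filter; foldr; length; lookup; map; take; upTo)
open import Data.List.Membership.Propositional using (_∈_; find)
open import Data.List.Membership.Propositional.Properties
open import Data.List.Membership.Propositional.Properties.WithK using (unique∧set⇒bag)
import Data.List.Properties as List
open import Data.List.Relation.Binary.BagAndSetEquality using (∼bag⇒↭)
open import Data.List.Relation.Binary.Disjoint.Propositional using (Disjoint)
open import Data.List.Relation.Binary.Permutation.Propositional using (_↭_; ↭⇒↭ₛ; ↭-sym)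
import Data.List.Relation.Binary.Permutation.Propositional.Properties as ↭
import Data.List.Relation.Binary.Permutation.Setoid.Properties as ↭ₛ
open import Data.List.Relation.Unary.All as All using ([]; _∷_)
import Data.List.Relation.Unary.All.Properties as All
open import Data.List.Relation.Unary.AllPairs as AllPairs using (AllPairs; []; _∷_)
import Data.List.Relation.Unary.AllPairs.Properties as AllPairs
open import Data.List.Relation.Unary.Any as Any using (Any; here; there)
import Data.List.Relation.Unary.Any.Properties as Any
open import Data.List.Relation.Unary.Linked using (Linked; []; [-]; _∷_)
open import Data.List.Relation.Unary.Unique.DecPropositional using (unique?)
open import Data.List.Relation.Unary.Unique.DecSetoid.Properties using (deduplicate-!)
open import Data.List.Relation.Unary.Unique.Propositional using (Unique)
import Data.List.Relation.Unary.Unique.Propositional.Properties as Unique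
open import Data.Nat.Base
open import Data.Nat.Combinatorics using (_C_; nCk+nC[k+1]≡[n+1]C[k+1])
open import Data.Nat.Divisibility
open import Data.Nat.DivMod
open import Data.Nat.GCD
open import Data.Nat.GeneralisedArithmetic using (iterate)
open import Data.Nat.ListAction.Properties using (∈⇒∣product)
open import Data.Nat.Primality using (Prime; euclidsLemma)
open import Data.Nat.Primality.Factorisation
open PrimeFactorisation using (isFactorisation; factorsPrime)
import Data.Nat.Properties as ℕ
import Data.Nat.Tactic.RingSolver as ℕ-Solver
open import Data.Product.Base as Product using (_×_; _,_; proj₁; proj₂; ∃-syntax; map₁; uncurry)
open import Data.Rational.Base as ℚ using ()
import Data.Rational.Properties as ℚ
open import Data.Rational.Unnormalised.Base as ℚᵘ using (mkℚᵘ; *≡*)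
import Data.Rational.Unnormalised.Properties as ℚᵘ
open import Data.Sum.Base using (inj₁; inj₂)
open import Function.Base using (_∘_)
open import Function.Bundles using (mk⇔)
open import Relation.Binary.Bundles using (DecSetoid)
import Relation.Binary.Construct.Closure.Equivalence as EqClosure
open import Relation.Binary.Construct.Closure.ReflexiveTransitive using (ε; _◅_; _◅◅_)
open import Relation.Binary.Construct.Closure.Symmetric using (fwd; bwd)
open import Relation.Binary.Definitions using (DecidableEquality)
open import Relation.Binary.PropositionalEquality hiding ([_])
open import Relation.Nullary.Decidable using (Dec; yes; no; does; map′; ¬?; _→-dec_; dec-true; dec-false)
open import Relation.Nullary.Negation using (¬_; contradiction)
open import Relation.Unary using (Decidable)
open ≡-Reasoning

-- Finite sums

-- Primitivity is a negative statement about all circuits, all exponents and all rotations, so it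
-- cannot be tested as it stands. It is replaced by aperiodicity, the absence of a return time j
-- with 0 < j < l under σ, which is decidable. Return times are also easy to compare: all of them
-- are multiples of the least one. This is why invariance under σ^(l/m), rather than being an m-th
-- power, is the relation that is double counted. The number ω enters because the m-th root of a
-- circuit must close up by itself: its transit distance is ω n / m, and this is a multiple of n
-- exactly when m divides ω. Finite sets are duplicate-free lists, and a bijection between two of
-- them is a permutation obtained from equality of members; it then carries a sum or a length
-- across. The count takes place in ℤ, as an identity l N = n S, and the quotient n / l is formed
-- only at the end.

unique∧set⇒↭ : ∀ {A : Set} {xs ys : List A} → Unique xs → Unique ys →
  (∀ {x} → x ∈ xs → x ∈ ys) → (∀ {x} → x ∈ ys → x ∈ xs) → xs ↭ ys
unique∧set⇒↭ xs! ys! xs⊆ys ys⊆xs = ∼bag⇒↭ (unique∧set⇒bag xs! ys! (mk⇔ xs⊆ys ys⊆xs))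

-- Built from the same `foldr` and `map` as `divisorSum`, so that a `divisorSum` unfolds to a `∑`
-- over `divisors` without a conversion.
∑ : ∀ {A : Set} → List A → (A → ℤ) → ℤ
∑ xs f = foldr ℤ._+_ 0ℤ (map f xs)

module _ {A : Set} where

  ∑-cong : ∀ (xs : List A) {f g : A → ℤ} → (∀ {x} → x ∈ xs → f x ≡ g x) → ∑ xs f ≡ ∑ xs g
  ∑-cong []       f≗g = refl
  ∑-cong (x ∷ xs) f≗g = cong₂ ℤ._+_ (f≗g (here refl)) (∑-cong xs (f≗g ∘ there))

  ∑-zero : ∀ (xs : List A) → ∑ xs (λ _ → 0ℤ) ≡ 0ℤ
  ∑-zero []       = refl
  ∑-zero (x ∷ xs) = trans (ℤ.+-identityˡ _) (∑-zero xs)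

  ∑-↭ : ∀ {xs ys : List A} (f : A → ℤ) → xs ↭ ys → ∑ xs f ≡ ∑ ys f
  ∑-↭ f xs↭ys = ↭ₛ.foldr-commMonoid (setoid ℤ) ℤ.+-0-isCommutativeMonoid (↭⇒↭ₛ (↭.map⁺ f xs↭ys))

  ∑-+ : ∀ (xs : List A) (f g : A → ℤ) → ∑ xs (λ x → f x ℤ.+ g x) ≡ ∑ xs f ℤ.+ ∑ xs g
  ∑-+ []       f g = refl
  ∑-+ (x ∷ xs) f g = trans (cong (ℤ._+_ (f x ℤ.+ g x)) (∑-+ xs f g)) (interchange (f x) (g x) (∑ xs f) (∑ xs g))
    where
    interchange : ∀ p q r s → p ℤ.+ q ℤ.+ (r ℤ.+ s) ≡ p ℤ.+ r ℤ.+ (q ℤ.+ s)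
    interchange = ℤ-Solver.solve-∀

  ∑-*ˡ : ∀ (xs : List A) (z : ℤ) (f : A → ℤ) → ∑ xs (λ x → z ℤ.* f x) ≡ z ℤ.* ∑ xs f
  ∑-*ˡ []       z f = sym (ℤ.*-zeroʳ z)
  ∑-*ˡ (x ∷ xs) z f = trans (cong (ℤ._+_ (z ℤ.* f x)) (∑-*ˡ xs z f)) (sym (ℤ.*-distribˡ-+ z (f x) _))

  ∑-const : ∀ (xs : List A) (z : ℤ) → ∑ xs (λ _ → z) ≡ z ℤ.* + length xs
  ∑-const []       z = sym (ℤ.*-zeroʳ z)
  ∑-const (x ∷ xs) z = trans (cong (ℤ._+_ z) (∑-const xs z)) (sym (ℤ.*-suc z (+ length xs)))

  ∑-filter : ∀ {P : A → Set} (P? : Decidable P) (xs : List A) (f : A → ℤ) →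
    ∑ (filter P? xs) f ≡ ∑ xs (λ x → if does (P? x) then f x else 0ℤ)
  ∑-filter P? []       f = refl
  ∑-filter P? (x ∷ xs) f with does (P? x)
  ... | true  = cong (ℤ._+_ (f x)) (∑-filter P? xs f)
  ... | false = trans (∑-filter P? xs f) (sym (ℤ.+-identityˡ _))

  ∑-split : ∀ {P : A → Set} (P? : Decidable P) (xs : List A) (f : A → ℤ) →
    ∑ xs f ≡ ∑ (filter P? xs) f ℤ.+ ∑ (filter (¬? ∘ P?) xs) f
  ∑-split P? []       f = refl
  ∑-split P? (x ∷ xs) f with does (P? x)
  ... | true  = trans (cong (ℤ._+_ (f x)) (∑-split P? xs f)) (sym (ℤ.+-assoc (f x) _ _))
  ... | false = trans (cong (ℤ._+_ (f x)) (∑-split P? xs f)) (swap (f x) (∑ (filter P? xs) f) _)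
    where
    swap : ∀ p q r → p ℤ.+ (q ℤ.+ r) ≡ q ℤ.+ (p ℤ.+ r)
    swap = ℤ-Solver.solve-∀

  ∑-map : ∀ {B : Set} (h : B → A) (xs : List B) (f : A → ℤ) → ∑ (map h xs) f ≡ ∑ xs (f ∘ h)
  ∑-map h xs f = cong (foldr ℤ._+_ 0ℤ) (sym (List.map-∘ xs))

∑-swap : ∀ {A B : Set} (xs : List A) (ys : List B) (f : A → B → ℤ) →
  ∑ xs (λ x → ∑ ys (f x)) ≡ ∑ ys (λ y → ∑ xs (λ x → f x y))
∑-swap []       ys f = sym (∑-zero ys)
∑-swap (x ∷ xs) ys f =
  trans (cong (ℤ._+_ (∑ ys (f x))) (∑-swap xs ys f)) (sym (∑-+ ys (f x) (λ y → ∑ xs (λ x → f x y))))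

-- Double counting of the pairs related by `R`: written with indicators, both sides have the same
-- summand, and finite sums commute.
∑-filter-swap : ∀ {A B : Set} {R : A → B → Set} (R? : ∀ x y → Dec (R x y))
  (xs : List A) (ys : List B) (f : A → B → ℤ) →
  ∑ xs (λ x → ∑ (filter (R? x) ys) (f x)) ≡ ∑ ys (λ y → ∑ (filter (λ x → R? x y) xs) (λ x → f x y))
∑-filter-swap R? xs ys f = begin
  ∑ xs (λ x → ∑ (filter (R? x) ys) (f x))
    ≡⟨ ∑-cong xs (λ {x} _ → ∑-filter (R? x) ys (f x)) ⟩
  ∑ xs (λ x → ∑ ys (λ y → if does (R? x y) then f x y else 0ℤ))
    ≡⟨ ∑-swap xs ys _ ⟩
  ∑ ys (λ y → ∑ xs (λ x → if does (R? x y) then f x y else 0ℤ))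
    ≡⟨ ∑-cong ys (λ {y} _ → ∑-filter (λ x → R? x y) xs (λ x → f x y)) ⟨
  ∑ ys (λ y → ∑ (filter (λ x → R? x y) xs) (λ x → f x y)) ∎

-- Möbius function

-- Divisors m are represented by m − 1, as in divisorSum.
divisors : ℕ → List ℕ
divisors g = filter (λ i → suc i ∣? g) (upTo g)

∈-divisors⁺ : ∀ {g i} .{{_ : NonZero g}} → suc i ∣ g → i ∈ divisors g
∈-divisors⁺ d = ∈-filter⁺ _ (∈-upTo⁺ (∣⇒≤ d)) d

∈-divisors⁻ : ∀ {g i} → i ∈ divisors g → suc i ∣ g
∈-divisors⁻ {g} = proj₂ ∘ ∈-filter⁻ (λ i → suc i ∣? g) {xs = upTo g}

divisors-! : ∀ g → Unique (divisors g)
divisors-! g = Unique.filter⁺ (λ i → suc i ∣? g) (Unique.upTo⁺ g)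

-- The value of μ on a number with the given prime factors.
sign : List ℕ → ℤ
sign ps = if does (unique? ℕ._≟_ ps) then -1ℤ ℤ.^ length ps else 0ℤ

Unique-resp-↭ : ∀ {xs ys : List ℕ} → xs ↭ ys → Unique xs → Unique ys
Unique-resp-↭ p = ↭ₛ.Unique-resp-↭ (setoid ℕ) (↭⇒↭ₛ p)

sign-unique : ∀ {ps} → Unique ps → sign ps ≡ -1ℤ ℤ.^ length ps
sign-unique {ps} ps! rewrite dec-true (unique? ℕ._≟_ ps) ps! = refl

sign-¬unique : ∀ {ps} → ¬ Unique ps → sign ps ≡ 0ℤ
sign-¬unique {ps} ¬ps! rewrite dec-false (unique? ℕ._≟_ ps) ¬ps! = refl

-- The order in which `factorise` lists the primes of a product is not controlled; unique
-- factorisation determines it only up to permutation.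
sign-↭ : ∀ {ps qs} → ps ↭ qs → sign ps ≡ sign qs
sign-↭ {ps} {qs} ps↭qs with unique? ℕ._≟_ ps
... | yes ps! = trans (cong (-1ℤ ℤ.^_) (↭.↭-length ps↭qs)) (sym (sign-unique (Unique-resp-↭ ps↭qs ps!)))
... | no ¬ps! = sym (sign-¬unique (¬ps! ∘ Unique-resp-↭ (↭-sym ps↭qs)))

factors-* : ∀ {p} m .{{_ : NonZero m}} .{{_ : NonZero (p * m)}} → Prime p →
  factors (factorise (p * m)) ↭ p ∷ factors (factorise m)
factors-* {p} m pr = factorisationUnique (factorise (p * m)) record
  { factors         = p ∷ factors (factorise m)
  ; isFactorisation = cong (p *_) (isFactorisation (factorise m))
  ; factorsPrime    = pr ∷ factorsPrime (factorise m)
  }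

∈-factors⁻ : ∀ {p} m .{{_ : NonZero m}} → p ∈ factors (factorise m) → p ∣ m
∈-factors⁻ {p} m p∈ = subst (p ∣_) (sym (isFactorisation (factorise m))) (∈⇒∣product p∈)

∈-factors⁺ : ∀ {p} m .{{_ : NonZero m}} → Prime p → p ∣ m → p ∈ factors (factorise m)
∈-factors⁺ {p} m pr p∣m = factorisationHasAllPrimeFactors pr
  (subst (p ∣_) (isFactorisation (factorise m)) p∣m) (factorsPrime (factorise m))

-- A prime that does not divide m is a new entry of the factor list: freedom from repetition is
-- unaffected and the length grows by one.
μ-*-∤ : ∀ {p} m .{{_ : NonZero m}} .{{_ : NonZero (p * m)}} → Prime p → ¬ p ∣ m → μ (p * m) ≡ ℤ.- μ m
μ-*-∤ {p} m pr p∤m = trans (sign-↭ (factors-* m pr)) (extend (unique? ℕ._≟_ ps))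
  where
  ps : List ℕ
  ps = factors (factorise m)

  extend : Dec (Unique ps) → sign (p ∷ ps) ≡ ℤ.- sign ps
  extend (yes ps!) = begin
    sign (p ∷ ps)                ≡⟨ sign-unique (All.¬Any⇒All¬ ps (p∤m ∘ ∈-factors⁻ m) ∷ ps!) ⟩
    -1ℤ ℤ.* -1ℤ ℤ.^ length ps    ≡⟨ ℤ.-1*i≡-i (-1ℤ ℤ.^ length ps) ⟩
    ℤ.- (-1ℤ ℤ.^ length ps)      ≡⟨ cong ℤ.-_ (sign-unique ps!) ⟨
    ℤ.- sign ps                  ∎
  extend (no ¬ps!) = trans (sign-¬unique (¬ps! ∘ AllPairs.tail)) (cong ℤ.-_ (sym (sign-¬unique ¬ps!)))

μ-*-∣ : ∀ {p} m .{{_ : NonZero m}} .{{_ : NonZero (p * m)}} → Prime p → p ∣ m → μ (p * m) ≡ 0ℤ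
μ-*-∣ {p} m pr p∣m = trans (sign-↭ (factors-* m pr))
  (sign-¬unique {p ∷ factors (factorise m)} λ { (p∉ ∷ _) → All.All¬⇒¬Any p∉ (∈-factors⁺ m pr p∣m) })

∃-prime-divisor : ∀ m .{{_ : NonZero m}} → m ≢ 1 → ∃[ p ] (Prime p × p ∣ m)
∃-prime-divisor m m≢1 with factorise m in eq
... | record { factors = [] ; isFactorisation = m≡1 } = contradiction m≡1 m≢1
... | record { factors = p ∷ ps ; isFactorisation = m≡ ; factorsPrime = pr ∷ _ } =
  p , pr , subst (p ∣_) (sym m≡) (m∣m*n _)

-- The squarefree divisors of e cancel in pairs m, p m for a fixed prime p ∣ e with p ∤ m.
∑μ≡0 : ∀ e .{{_ : NonZero e}} → e ≢ 1 → ∑ (divisors e) (λ i → μ (suc i)) ≡ 0ℤ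
∑μ≡0 e e≢1 with ∃-prime-divisor e e≢1
... | p@(suc p′) , pr , p∣e = begin
  ∑ (divisors e) μ₁                      ≡⟨ ∑-split p∣?_ (divisors e) μ₁ ⟩
  ∑ D μ₁ ℤ.+ ∑ D₀ μ₁                     ≡⟨ cong (ℤ._+ ∑ D₀ μ₁) (∑-split p²∣?_ D μ₁) ⟩
  (∑ D₂ μ₁ ℤ.+ ∑ D₁ μ₁) ℤ.+ ∑ D₀ μ₁      ≡⟨ cong₂ (λ s t → (s ℤ.+ t) ℤ.+ ∑ D₀ μ₁) ∑D₂ ∑D₁ ⟩
  (0ℤ ℤ.+ (-1ℤ ℤ.* ∑ D₀ μ₁)) ℤ.+ ∑ D₀ μ₁ ≡⟨ cancel (∑ D₀ μ₁) ⟩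
  0ℤ                                     ∎
  where
  μ₁ : ℕ → ℤ
  μ₁ i = μ (suc i)

  p∣?_ : Decidable (λ i → p ∣ suc i)
  p∣? i = p ∣? suc i

  p²∣?_ : Decidable (λ i → p * p ∣ suc i)
  p²∣? i = p * p ∣? suc i

  -- The index tells how often p occurs in the divisor: not at all, exactly once, at least twice.
  D D₀ D₂ D₁ : List ℕ
  D  = filter p∣?_ (divisors e)
  D₀ = filter (¬? ∘ p∣?_) (divisors e)
  D₂ = filter p²∣?_ D
  D₁ = filter (¬? ∘ p²∣?_) D

  cancel : ∀ z → (0ℤ ℤ.+ (-1ℤ ℤ.* z)) ℤ.+ z ≡ 0ℤ
  cancel = ℤ-Solver.solve-∀

  ∑D₂ : ∑ D₂ μ₁ ≡ 0ℤ
  ∑D₂ = trans (∑-cong D₂ vanish) (∑-zero D₂)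
    where
    vanish : ∀ {i} → i ∈ D₂ → μ₁ i ≡ 0ℤ
    vanish {i} i∈ with proj₂ (∈-filter⁻ p²∣?_ {xs = D} i∈)
    ... | divides q@(suc _) eq = trans (cong-μ 1+i≡) (μ-*-∣ (p * q) pr (m∣m*n q))
      where
      1+i≡ : suc i ≡ p * (p * q)
      1+i≡ = trans eq (trans (ℕ.*-comm q (p * p)) (ℕ.*-assoc p p q))
      -- The `NonZero` instance of `μ` depends on its argument, so the equality is matched instead
      -- of being passed to `cong`.
      cong-μ : ∀ {x y} .{{_ : NonZero x}} .{{_ : NonZero y}} → x ≡ y → μ x ≡ μ y
      cong-μ refl = refl

  -- Multiplication by p in the shifted indexing: suc (p* i) is p * suc i.
  p*_ : ℕ → ℕ
  p* i = i + p′ * suc i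

  p*-injective : ∀ {i j} → p* i ≡ p* j → i ≡ j
  p*-injective {i} {j} eq = ℕ.suc-injective (ℕ.*-cancelˡ-≡ (suc i) (suc j) p (cong suc eq))

  D₁↭ : D₁ ↭ map p*_ D₀
  D₁↭ = unique∧set⇒↭
    (Unique.filter⁺ (¬? ∘ p²∣?_) (Unique.filter⁺ p∣?_ (divisors-! e)))
    (Unique.map⁺ p*-injective (Unique.filter⁺ (¬? ∘ p∣?_) (divisors-! e)))
    to from
    where
    to : ∀ {i} → i ∈ D₁ → i ∈ map p*_ D₀
    to {i} i∈ with ∈-filter⁻ (¬? ∘ p²∣?_) {xs = D} i∈
    ... | i∈D , p²∤ with ∈-filter⁻ p∣?_ {xs = divisors e} i∈D
    ... | i∈div , divides (suc j) eq = subst (_∈ map p*_ D₀) (sym i≡) (∈-map⁺ p*_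
        (∈-filter⁺ _ (∈-divisors⁺ (∣-trans (divides p (trans eq (ℕ.*-comm (suc j) p))) (∈-divisors⁻ i∈div)))
          (λ p∣j → p²∤ (subst (p * p ∣_) (sym eq) (*-monoˡ-∣ p p∣j)))))
      where
      i≡ : i ≡ p* j
      i≡ = ℕ.suc-injective (trans eq (ℕ.*-comm (suc j) p))
    from : ∀ {i} → i ∈ map p*_ D₀ → i ∈ D₁
    from i∈ with ∈-map⁻ p*_ i∈
    ... | j , j∈D₀ , refl with ∈-filter⁻ (¬? ∘ p∣?_) {xs = divisors e} j∈D₀
    ... | j∈div , p∤j = ∈-filter⁺ _ (∈-filter⁺ _ (∈-divisors⁺ p*j∣e) (m∣m*n (suc j)))
        (λ p²∣ → p∤j (*-cancelˡ-∣ p p²∣))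
      where
      -- Here p ∣ e is used: in e = q (j + 1) the prime p does not divide j + 1, so it divides q and
      -- leaves room for one more factor p.
      p*j∣e : p * suc j ∣ e
      p*j∣e with ∈-divisors⁻ {e} j∈div
      ... | divides q eq with euclidsLemma q (suc j) pr (subst (p ∣_) eq p∣e)
      ... | inj₁ p∣q = subst (p * suc j ∣_) (sym eq) (*-monoˡ-∣ (suc j) p∣q)
      ... | inj₂ p∣j = contradiction p∣j p∤j

  ∑D₁ : ∑ D₁ μ₁ ≡ -1ℤ ℤ.* ∑ D₀ μ₁
  ∑D₁ = begin
    ∑ D₁ μ₁                    ≡⟨ ∑-↭ μ₁ D₁↭ ⟩
    ∑ (map p*_ D₀) μ₁          ≡⟨ ∑-map p*_ D₀ μ₁ ⟩
    ∑ D₀ (μ₁ ∘ p*_)            ≡⟨ ∑-cong D₀ (λ {j} j∈D₀ → trans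
                                    (μ-*-∤ (suc j) pr (proj₂ (∈-filter⁻ (¬? ∘ p∣?_) {xs = divisors e} j∈D₀)))
                                    (sym (ℤ.-1*i≡-i (μ₁ j)))) ⟩
    ∑ D₀ (λ i → -1ℤ ℤ.* μ₁ i)  ≡⟨ ∑-*ˡ D₀ -1ℤ μ₁ ⟩
    -1ℤ ℤ.* ∑ D₀ μ₁            ∎

-- Minimal periods

least : ∀ {P : ℕ → Set} → Decidable P → ∀ m → P m → ∃[ p ] (P p × (∀ {q} → q < p → ¬ P q))
least P? zero    Pm = zero , Pm , λ ()
least P? (suc m) Pm with P? zero
... | yes P0 = zero , P0 , λ ()
... | no ¬P0 with least (P? ∘ suc) m Pm
... | p , Pp , min = suc p , Pp , λ { {zero} _ → ¬P0 ; {suc q} (s≤s q<p) → min q<p }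

module _ {X : Set} (f : X → X) where

  iterate-+ : ∀ x m n → iterate f x (m + n) ≡ iterate f (iterate f x m) n
  iterate-+ x zero    n = refl
  iterate-+ x (suc m) n = iterate-+ (f x) m n

  iterate-* : ∀ {x p} → iterate f x p ≡ x → ∀ q → iterate f x (q * p) ≡ x
  iterate-*         fᵖ≡ zero    = refl
  iterate-* {x} {p} fᵖ≡ (suc q) =
    trans (iterate-+ x p (q * p)) (trans (cong (λ y → iterate f y (q * p)) fᵖ≡) (iterate-* fᵖ≡ q))

  iterate-∣ : ∀ {x p j} → iterate f x p ≡ x → p ∣ j → iterate f x j ≡ x
  iterate-∣ fᵖ≡ (divides q refl) = iterate-* fᵖ≡ q

  iterate-% : ∀ {x p} .{{_ : NonZero p}} → iterate f x p ≡ x → ∀ j → iterate f x j ≡ iterate f x (j % p)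
  iterate-% {x} {p} fᵖ≡ j = begin
    iterate f x j                                  ≡⟨ cong (iterate f x) (trans (m≡m%n+[m/n]*n j p) (ℕ.+-comm (j % p) _)) ⟩
    iterate f x (j / p * p + j % p)                ≡⟨ iterate-+ x (j / p * p) (j % p) ⟩
    iterate f (iterate f x (j / p * p)) (j % p)    ≡⟨ cong (λ y → iterate f y (j % p)) (iterate-* fᵖ≡ (j / p)) ⟩
    iterate f x (j % p)                            ∎

  iterate-preserves : ∀ {P : X → Set} → (∀ {x} → P x → P (f x)) → ∀ {x} j → P x → P (iterate f x j)
  iterate-preserves f-pres zero    Px = Px
  iterate-preserves {P} f-pres (suc j) Px = iterate-preserves {P} f-pres j (f-pres Px)

  -- The search runs over the exponents i + 1, which skips the trivial return time 0. The remainder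
  -- of any return time modulo the least positive one is again a return time, and a smaller one,
  -- hence 0.
  minimal-period : DecidableEquality X → ∀ {x} l .{{_ : NonZero l}} → iterate f x l ≡ x →
    ∃[ p ] (NonZero p × iterate f x p ≡ x × (∀ {j} → iterate f x j ≡ x → p ∣ j))
  minimal-period _≟_ {x} (suc l) fˡ≡ with least (λ i → iterate f x (suc i) ≟ x) l fˡ≡
  ... | p , fᵖ≡ , min = suc p , _ , fᵖ≡ , λ {j} fʲ≡ →
    m%n≡0⇒n∣m j (suc p) (remainder≡0 (j % suc p) (m%n<n j (suc p)) (trans (sym (iterate-% fᵖ≡ j)) fʲ≡))
    where
    remainder≡0 : ∀ r → r < suc p → iterate f x r ≡ x → r ≡ 0
    remainder≡0 zero    _         _   = refl
    remainder≡0 (suc r) (s≤s r<p) fʳ≡ = contradiction fʳ≡ (min r<p)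

-- Concatenation, repetition and chains in lists.

module _ {A : Set} where

  ++-injective : ∀ (ws : List A) {xs ys zs} → length ws ≡ length xs → ws ++ ys ≡ xs ++ zs → ws ≡ xs × ys ≡ zs
  ++-injective []       {[]}     _    eq = refl , eq
  ++-injective (w ∷ ws) {x ∷ xs} |≡| eq with List.∷-injective eq
  ... | refl , eq′ = map₁ (cong (w ∷_)) (++-injective ws (ℕ.suc-injective |≡|) eq′)

  -- Injectivity is asked on the members of `xs` only: powers are compared among circuits of one
  -- length, and rotations j among j < l.
  map-! : ∀ {B : Set} (f : A → B) {xs} → (∀ {x y} → x ∈ xs → y ∈ xs → f x ≡ f y → x ≡ y) →
    Unique xs → Unique (map f xs)
  map-! f {[]}     f-inj []        = []
  map-! f {x ∷ xs} f-inj (x∉ ∷ xs!) =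
    All.tabulate (λ fy∈ fx≡fy → let (y , y∈ , eq) = ∈-map⁻ f fy∈ in
      All.lookup x∉ y∈ (f-inj (here refl) (there y∈) (trans fx≡fy eq)))
    ∷ map-! f (λ x∈ y∈ → f-inj (there x∈) (there y∈)) xs!

  length-cartesianProduct : ∀ {B : Set} (xs : List A) (ys : List B) →
    length (cartesianProduct xs ys) ≡ length xs * length ys
  length-cartesianProduct []       ys = refl
  length-cartesianProduct (x ∷ xs) ys = trans (List.length-++ (map (x ,_) ys))
    (cong₂ _+_ (List.length-map (x ,_) ys) (length-cartesianProduct xs ys))

  -- The two pieces overlap in `y`, which preserves the link across the cut; closed paths can thus
  -- be cut and glued at the bond to which they return.
  Linked-++⁻ : ∀ {R : A → A → Set} xs {y zs} → Linked R (xs ++ y ∷ zs) → Linked R (xs ∷ʳ y) × Linked R (y ∷ zs)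
  Linked-++⁻ []           ys        = [-] , ys
  Linked-++⁻ (x ∷ [])     (r ∷ ys)  = r ∷ [-] , ys
  Linked-++⁻ (x ∷ w ∷ xs) (r ∷ wxs) = map₁ (r ∷_) (Linked-++⁻ (w ∷ xs) wxs)

  Linked-++⁺ : ∀ {R : A → A → Set} xs {y zs} → Linked R (xs ∷ʳ y) → Linked R (y ∷ zs) → Linked R (xs ++ y ∷ zs)
  Linked-++⁺ []           _         ys = ys
  Linked-++⁺ (x ∷ [])     (r ∷ _)   ys = r ∷ ys
  Linked-++⁺ (x ∷ w ∷ xs) (r ∷ wxs) ys = r ∷ Linked-++⁺ (w ∷ xs) wxs ys

-- Circuits and their enumeration

module Circuits (n a b : ℕ) .{{_ : NonZero n}} where

  open CirculantDigraph n a b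

  -- Rotations and powers of bond sequences.

  σ^-++ : ∀ xs ys → iterate σ (xs ++ ys) (length xs) ≡ ys ++ xs
  σ^-++ []       ys = sym (List.++-identityʳ ys)
  σ^-++ (x ∷ xs) ys = begin
    iterate σ ((xs ++ ys) ∷ʳ x) (length xs) ≡⟨ cong (λ zs → iterate σ zs (length xs)) (List.++-assoc xs ys [ x ]) ⟩
    iterate σ (xs ++ ys ∷ʳ x) (length xs)   ≡⟨ σ^-++ xs (ys ∷ʳ x) ⟩
    (ys ∷ʳ x) ++ xs                         ≡⟨ List.++-assoc ys [ x ] xs ⟩
    ys ++ x ∷ xs                            ∎

  σ^-length : ∀ c → iterate σ c (length c) ≡ c
  σ^-length c = subst (λ d → iterate σ d (length c) ≡ c) (List.++-identityʳ c) (σ^-++ c [])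

  length-σ : ∀ c → length (σ c) ≡ length c
  length-σ []       = refl
  length-σ (e ∷ es) = List.length-++-comm es [ e ]

  bCount-++ : ∀ xs ys → bCount (xs ++ ys) ≡ bCount xs + bCount ys
  bCount-++ []       ys = refl
  bCount-++ (x ∷ xs) ys with step x
  ... | a-step = bCount-++ xs ys
  ... | b-step = cong suc (bCount-++ xs ys)

  bCount-σ : ∀ c → bCount (σ c) ≡ bCount c
  bCount-σ []       = refl
  bCount-σ (e ∷ es) = begin
    bCount (es ∷ʳ e)            ≡⟨ bCount-++ es [ e ] ⟩
    bCount es + bCount [ e ]    ≡⟨ ℕ.+-comm (bCount es) _ ⟩
    bCount [ e ] + bCount es    ≡⟨ bCount-++ [ e ] es ⟨
    bCount (e ∷ es)             ∎

  length-^^ : ∀ c r → length (c ^^ r) ≡ r * length c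
  length-^^ c zero    = refl
  length-^^ c (suc r) = trans (List.length-++ c) (cong (_+_ (length c)) (length-^^ c r))

  bCount-^^ : ∀ c r → bCount (c ^^ r) ≡ r * bCount c
  bCount-^^ c zero    = refl
  bCount-^^ c (suc r) = trans (bCount-++ c (c ^^ r)) (cong (_+_ (bCount c)) (bCount-^^ c r))

  ^^-comm : ∀ c r → c ++ c ^^ r ≡ c ^^ r ++ c
  ^^-comm c zero    = List.++-identityʳ c
  ^^-comm c (suc r) = trans (cong (c ++_) (^^-comm c r)) (sym (List.++-assoc c (c ^^ r) c))

  σ^-^^ : ∀ c r → iterate σ (c ^^ suc r) (length c) ≡ c ^^ suc r
  σ^-^^ c r = trans (σ^-++ c (c ^^ r)) (sym (^^-comm c r))

  -- A case of the fact that commuting words are powers of a common word. Comparing prefixes shows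
  -- that `ys` starts with `xs`; after cancelling this block the rest still commutes with `xs` and
  -- is one block shorter.
  commute⇒power : ∀ q xs ys → length ys ≡ q * length xs → xs ++ ys ≡ ys ++ xs → ys ≡ xs ^^ q
  commute⇒power zero    xs []  _   _    = refl
  commute⇒power (suc q) xs ys |ys| comm = begin
    ys                  ≡⟨ ys≡ ⟨
    ts ++ ds            ≡⟨ cong₂ _++_ (proj₁ split) (commute⇒power q xs ds |ds| ds-comm) ⟩
    xs ++ xs ^^ q       ∎
    where
    ts ds : List Bond
    ts = take (length xs) ys
    ds = drop (length xs) ys
    ys≡ : ts ++ ds ≡ ys
    ys≡ = List.take++drop≡id (length xs) ys
    |ts| : length ts ≡ length xs
    |ts| = trans (List.length-take (length xs) ys)
      (ℕ.m≤n⇒m⊓n≡m (subst (length xs ≤_) (sym |ys|) (ℕ.m≤m+n (length xs) _)))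
    |ds| : length ds ≡ q * length xs
    |ds| = trans (List.length-drop (length xs) ys)
      (trans (cong (_∸ length xs) |ys|) (ℕ.m+n∸m≡n (length xs) _))
    split : ts ≡ xs × ds ++ xs ≡ ys
    split = ++-injective ts |ts| (begin
      ts ++ ds ++ xs    ≡⟨ List.++-assoc ts ds xs ⟨
      (ts ++ ds) ++ xs  ≡⟨ cong (_++ xs) ys≡ ⟩
      ys ++ xs          ≡⟨ comm ⟨
      xs ++ ys          ∎)
    ds-comm : xs ++ ds ≡ ds ++ xs
    ds-comm = trans (cong (_++ ds) (sym (proj₁ split))) (trans ys≡ (sym (proj₂ split)))

  -- Rotation by p moves the prefix of length p behind the rest, so invariance says that prefix and
  -- rest commute as words.
  periodic⇒power : ∀ m p c → length c ≡ suc m * p → iterate σ c p ≡ c → c ≡ take p c ^^ suc m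
  periodic⇒power m p c |c| σᵖ≡ = begin
    c                     ≡⟨ c≡ ⟨
    ts ++ ds              ≡⟨ cong (ts ++_) (commute⇒power m ts ds |ds| (trans c≡ (sym comm))) ⟩
    ts ++ ts ^^ m         ∎
    where
    ts ds : List Bond
    ts = take p c
    ds = drop p c
    c≡ : ts ++ ds ≡ c
    c≡ = List.take++drop≡id p c
    |ts| : length ts ≡ p
    |ts| = trans (List.length-take p c) (ℕ.m≤n⇒m⊓n≡m (subst (p ≤_) (sym |c|) (ℕ.m≤m+n p _)))
    |ds| : length ds ≡ m * length ts
    |ds| = begin
      length ds       ≡⟨ List.length-drop p c ⟩
      length c ∸ p    ≡⟨ cong (_∸ p) |c| ⟩
      suc m * p ∸ p   ≡⟨ ℕ.m+n∸m≡n p _ ⟩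
      m * p           ≡⟨ cong (m *_) |ts| ⟨
      m * length ts   ∎
    comm : ds ++ ts ≡ c
    comm = begin
      ds ++ ts                          ≡⟨ σ^-++ ts ds ⟨
      iterate σ (ts ++ ds) (length ts)  ≡⟨ cong₂ (iterate σ) c≡ |ts| ⟩
      iterate σ c p                     ≡⟨ σᵖ≡ ⟩
      c                                 ∎

  ^^-injective : ∀ m {c d} → length c ≡ length d → c ^^ suc m ≡ d ^^ suc m → c ≡ d
  ^^-injective m {c} |≡| eq = proj₁ (++-injective c |≡| eq)

  -- Circuits as closed paths.

  ∷ʳ-path⁺ : ∀ e es {e′} → IsPath (e ∷ es) → terminus (lastBond e es) ≡ origin e′ → IsPath (e ∷ es ∷ʳ e′)
  ∷ʳ-path⁺ e []       _        r = r ∷ [-]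
  ∷ʳ-path⁺ e (f ∷ es) (s ∷ es′) r = s ∷ ∷ʳ-path⁺ f es es′ r

  ∷ʳ-path⁻ : ∀ e es {e′} → IsPath (e ∷ es ∷ʳ e′) → IsPath (e ∷ es) × terminus (lastBond e es) ≡ origin e′
  ∷ʳ-path⁻ e []       (r ∷ _)   = [-] , r
  ∷ʳ-path⁻ e (f ∷ es) (s ∷ es′) = map₁ (s ∷_) (∷ʳ-path⁻ f es es′)

  -- Repeating the first bond at the end turns the closing condition into one more link, so that
  -- rotations, powers and roots of circuits become cutting and gluing of paths.
  circuit⇒path : ∀ e es → IsCircuit (e ∷ es) → IsPath ((e ∷ es) ∷ʳ e)
  circuit⇒path e es = uncurry (∷ʳ-path⁺ e es)

  path⇒circuit : ∀ e es → IsPath ((e ∷ es) ∷ʳ e) → IsCircuit (e ∷ es)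
  path⇒circuit e es = ∷ʳ-path⁻ e es

  circuit-σ : ∀ {c} → IsCircuit c → IsCircuit (σ c)
  circuit-σ {e ∷ []}     circ = circ
  -- From the closed path e, f, ..., e the first link is removed and attached again behind the final
  -- e.
  circuit-σ {e ∷ f ∷ es} circ@(r ∷ _ , _) with circuit⇒path e (f ∷ es) circ
  ... | _ ∷ fese = path⇒circuit f (es ∷ʳ e)
    (subst IsPath (sym (List.++-assoc (f ∷ es) [ e ] [ f ])) (Linked-++⁺ (f ∷ es) fese (r ∷ [-])))

  circuit-^^⁺ : ∀ {c} m → IsCircuit c → IsCircuit (c ^^ suc m)
  circuit-^^⁺ {c@(e ∷ es)} m circ = path⇒circuit e (es ++ c ^^ m) (path m)
    where
    path : ∀ m → IsPath (c ^^ suc m ∷ʳ e)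
    path zero    = subst (λ d → IsPath (d ∷ʳ e)) (sym (List.++-identityʳ c)) (circuit⇒path e es circ)
    path (suc m) = subst IsPath (sym (List.++-assoc c (c ^^ suc m) [ e ]))
      (Linked-++⁺ c (circuit⇒path e es circ) (path m))

  -- The bond after the first copy of `c` is again the first bond of `c`, so the link that closes
  -- `c` already occurs in the closed path of the power.
  circuit-^^⁻ : ∀ {c} m → IsCircuit (c ^^ suc m) → IsCircuit c
  circuit-^^⁻ {[]}          zero    ()
  circuit-^^⁻ {[]}          (suc m) circ = circuit-^^⁻ {[]} m circ
  circuit-^^⁻ {c@(e ∷ es)}  zero    circ = subst IsCircuit (List.++-identityʳ c) circ
  circuit-^^⁻ {c@(e ∷ es)}  (suc m) circ = path⇒circuit e es
    (proj₁ (Linked-++⁻ c (subst IsPath (List.++-assoc c (c ^^ suc m) [ e ]) (circuit⇒path e _ circ))))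

  _≟ₛ_ : DecidableEquality Step
  a-step ≟ₛ a-step = yes refl
  a-step ≟ₛ b-step = no λ ()
  b-step ≟ₛ a-step = no λ ()
  b-step ≟ₛ b-step = yes refl

  _≟ᵇ_ : DecidableEquality Bond
  bond v s ≟ᵇ bond w t with v Fin.≟ w | s ≟ₛ t
  ... | yes refl | yes refl = yes refl
  ... | no v≢w   | _        = no (v≢w ∘ cong origin)
  ... | _        | no s≢t   = no (s≢t ∘ cong step)

  _≟_ : DecidableEquality (List Bond)
  _≟_ = List.≡-dec _≟ᵇ_

  -- Step words and the paths that they trace.

  count : List Step → ℕ
  count []           = 0
  count (a-step ∷ w) = count w
  count (b-step ∷ w) = suc (count w)

  -- Splitting by the first step gives Pascal's recursion, hence binomial coefficients as lengths.
  words : ℕ → ℕ → List (List Step)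
  words zero    zero    = [ [] ]
  words zero    (suc k) = []
  words (suc l) zero    = map (a-step ∷_) (words l zero)
  words (suc l) (suc k) = map (a-step ∷_) (words l (suc k)) ++ map (b-step ∷_) (words l k)

  length-words : ∀ l k → length (words l k) ≡ l C k
  length-words zero    zero    = refl
  length-words zero    (suc k) = refl
  length-words (suc l) zero    = trans (List.length-map _ (words l zero)) (length-words l zero)
  length-words (suc l) (suc k) = begin
    length (map (a-step ∷_) (words l (suc k)) ++ map (b-step ∷_) (words l k))
      ≡⟨ List.length-++ (map (a-step ∷_) (words l (suc k))) ⟩
    length (map (a-step ∷_) (words l (suc k))) + length (map (b-step ∷_) (words l k))
      ≡⟨ cong₂ _+_ (trans (List.length-map _ (words l (suc k))) (length-words l (suc k)))
                   (trans (List.length-map _ (words l k)) (length-words l k)) ⟩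
    l C suc k + l C k     ≡⟨ ℕ.+-comm (l C suc k) _ ⟩
    l C k + l C suc k     ≡⟨ nCk+nC[k+1]≡[n+1]C[k+1] l k ⟩
    suc l C suc k         ∎

  words-! : ∀ l k → Unique (words l k)
  words-! zero    zero    = [] ∷ []
  words-! zero    (suc k) = []
  words-! (suc l) zero    = Unique.map⁺ List.∷-injectiveʳ (words-! l zero)
  words-! (suc l) (suc k) = Unique.++⁺
    (Unique.map⁺ List.∷-injectiveʳ (words-! l (suc k)))
    (Unique.map⁺ List.∷-injectiveʳ (words-! l k))
    disjoint
    where
    disjoint : Disjoint (map (a-step ∷_) (words l (suc k))) (map (b-step ∷_) (words l k))
    disjoint (w∈a , w∈b) with ∈-map⁻ (a-step ∷_) w∈a | ∈-map⁻ (b-step ∷_) w∈b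
    ... | _ , _ , refl | _ , _ , ()

  ∈-words⁺ : ∀ w → w ∈ words (length w) (count w)
  ∈-words⁺ []           = here refl
  ∈-words⁺ (a-step ∷ w) with count w | ∈-words⁺ w
  ... | zero  | w∈ = ∈-map⁺ (a-step ∷_) w∈
  ... | suc k | w∈ = ∈-++⁺ˡ (∈-map⁺ (a-step ∷_) w∈)
  ∈-words⁺ (b-step ∷ w) = ∈-++⁺ʳ _ (∈-map⁺ (b-step ∷_) (∈-words⁺ w))

  ∈-words⁻ : ∀ l k {w} → w ∈ words l k → length w ≡ l × count w ≡ k
  ∈-words⁻ zero    zero    (here refl) = refl , refl
  ∈-words⁻ (suc l) zero    w∈ with ∈-map⁻ (a-step ∷_) w∈
  ... | w′ , w′∈ , refl = map₁ (cong suc) (∈-words⁻ l zero w′∈)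
  ∈-words⁻ (suc l) (suc k) w∈ with ∈-++⁻ (map (a-step ∷_) (words l (suc k))) w∈
  ... | inj₁ w∈a with ∈-map⁻ (a-step ∷_) w∈a
  ...   | w′ , w′∈ , refl = map₁ (cong suc) (∈-words⁻ l (suc k) w′∈)
  ∈-words⁻ (suc l) (suc k) w∈ | inj₂ w∈b with ∈-map⁻ (b-step ∷_) w∈b
  ...   | w′ , w′∈ , refl = Product.map (cong suc) (cong suc) (∈-words⁻ l k w′∈)

  -- A nonempty path is the same as a start vertex and a step word; this is the origin of the
  -- product of n and a binomial coefficient.
  trace : Vertex → List Step → List Bond
  trace v []      = []
  trace v (s ∷ w) = bond v s ∷ trace (terminus (bond v s)) w

  length-trace : ∀ v w → length (trace v w) ≡ length w
  length-trace v []      = refl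
  length-trace v (s ∷ w) = cong suc (length-trace _ w)

  bCount-trace : ∀ v w → bCount (trace v w) ≡ count w
  bCount-trace v []           = refl
  bCount-trace v (a-step ∷ w) = bCount-trace _ w
  bCount-trace v (b-step ∷ w) = cong suc (bCount-trace _ w)

  trace-path : ∀ v w → IsPath (trace v w)
  trace-path v []          = []
  trace-path v (s ∷ [])    = [-]
  trace-path v (s ∷ t ∷ w) = refl ∷ trace-path _ (t ∷ w)

  path⇒trace : ∀ e es → IsPath (e ∷ es) → e ∷ es ≡ trace (origin e) (map step (e ∷ es))
  path⇒trace e []       _        = refl
  path⇒trace e (f ∷ es) (r ∷ es′) = cong (e ∷_) (trans (path⇒trace f es es′)
    (cong (λ v → trace v (map step (f ∷ es))) (sym r)))

  trace-injectiveʳ : ∀ {v v′} w w′ → trace v w ≡ trace v′ w′ → w ≡ w′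
  trace-injectiveʳ []      []        _  = refl
  trace-injectiveʳ (s ∷ w) (s′ ∷ w′) eq =
    cong₂ _∷_ (cong step (List.∷-injectiveˡ eq)) (trace-injectiveʳ w w′ (List.∷-injectiveʳ eq))

  -- The empty word is excluded because its trace forgets the start vertex.
  trace-injectiveˡ : ∀ {v v′} w w′ → NonZero (length w) → trace v w ≡ trace v′ w′ → v ≡ v′
  trace-injectiveˡ (s ∷ w) (s′ ∷ w′) _ eq = cong origin (List.∷-injectiveˡ eq)

  transit : List Step → ℕ
  transit []      = 0
  transit (s ∷ w) = size s + transit w

  toℕ-mod : ∀ m → toℕ (m mod n) ≡ m % n
  toℕ-mod m = Fin.toℕ-fromℕ< (m%n<n m n)

  %-+-% : ∀ x y → (x % n + y) % n ≡ (x + y) % n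
  %-+-% x y = begin
    (x % n + y) % n            ≡⟨ %-distribˡ-+ (x % n) y n ⟩
    (x % n % n + y % n) % n    ≡⟨ cong (λ z → (z + y % n) % n) (m%n%n≡m%n x n) ⟩
    (x % n + y % n) % n        ≡⟨ %-distribˡ-+ x y n ⟨
    (x + y) % n                ∎

  terminus-trace : ∀ v s w →
    toℕ (terminus (lastBond (bond v s) (trace (terminus (bond v s)) w))) ≡ (toℕ v + transit (s ∷ w)) % n
  terminus-trace v s []      = trans (toℕ-mod _) (cong (λ x → (toℕ v + x) % n) (sym (ℕ.+-identityʳ (size s))))
  terminus-trace v s (t ∷ w) = begin
    _                                                      ≡⟨ terminus-trace _ t w ⟩
    (toℕ (terminus (bond v s)) + transit (t ∷ w)) % n      ≡⟨ cong (λ x → (x + transit (t ∷ w)) % n) (toℕ-mod _) ⟩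
    ((toℕ v + size s) % n + transit (t ∷ w)) % n           ≡⟨ %-+-% _ (transit (t ∷ w)) ⟩
    (toℕ v + size s + transit (t ∷ w)) % n                 ≡⟨ cong (_% n) (ℕ.+-assoc (toℕ v) _ _) ⟩
    (toℕ v + (size s + transit (t ∷ w))) % n               ∎

  -- Whether a trace closes depends on its word alone, so every vertex starts equally many circuits.
  trace-circuit⁺ : ∀ v w → NonZero (length w) → n ∣ transit w → IsCircuit (trace v w)
  trace-circuit⁺ v (s ∷ w) _ n∣t = trace-path v (s ∷ w) , Fin.toℕ-injective (begin
    _                                  ≡⟨ terminus-trace v s w ⟩
    (toℕ v + transit (s ∷ w)) % n      ≡⟨ %-remove-+ʳ (toℕ v) n∣t ⟩
    toℕ v % n                          ≡⟨ m<n⇒m%n≡m (Fin.toℕ<n v) ⟩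
    toℕ v                              ∎)

  trace-circuit⁻ : ∀ v w → IsCircuit (trace v w) → n ∣ transit w
  -- Closing up means that v + t leaves the remainder v modulo n; cancelling v shows that t is the
  -- quotient times n.
  trace-circuit⁻ v (s ∷ w) (_ , closed) = divides ((toℕ v + t) / n) (ℕ.+-cancelˡ-≡ (toℕ v) _ _ (begin
    toℕ v + t                               ≡⟨ m≡m%n+[m/n]*n (toℕ v + t) n ⟩
    (toℕ v + t) % n + (toℕ v + t) / n * n   ≡⟨ cong (_+ (toℕ v + t) / n * n)
                                                 (trans (sym (terminus-trace v s w)) (cong toℕ closed)) ⟩
    toℕ v + (toℕ v + t) / n * n             ∎))
    where
    t : ℕ
    t = transit (s ∷ w)

  -- Closure is not tested: for l > 0 all these paths have the same transit distance, so all of them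
  -- are circuits or none is. `∈-circuits⁻` therefore takes the divisibility by n as a premise.
  circuits : ℕ → ℕ → List (List Bond)
  circuits l k = map (uncurry trace) (cartesianProduct (allFin n) (words l k))

  length-circuits : ∀ l k → length (circuits l k) ≡ n * (l C k)
  length-circuits l k = begin
    length (circuits l k)                                 ≡⟨ List.length-map (uncurry trace) (cartesianProduct (allFin n) (words l k)) ⟩
    length (cartesianProduct (allFin n) (words l k))      ≡⟨ length-cartesianProduct (allFin n) (words l k) ⟩
    length (allFin n) * length (words l k)                ≡⟨ cong₂ _*_ (List.length-tabulate {n = n} (λ i → i)) (length-words l k) ⟩
    n * (l C k)                                           ∎

  circuits-! : ∀ l k .{{_ : NonZero l}} → Unique (circuits l k)
  circuits-! l@(suc _) k = map-! (uncurry trace) trace-injective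
    (Unique.cartesianProduct⁺ (Unique.allFin⁺ n) (words-! l k))
    where
    trace-injective : ∀ {x y} → x ∈ cartesianProduct (allFin n) (words l k) →
      y ∈ cartesianProduct (allFin n) (words l k) → uncurry trace x ≡ uncurry trace y → x ≡ y
    trace-injective {v , w} {v′ , w′} x∈ y∈ eq = cong₂ _,_
      (trace-injectiveˡ w w′ (subst NonZero (sym (proj₁ (∈-words⁻ l k (proj₂ (∈-cartesianProduct⁻ (allFin n) (words l k) x∈))))) _) eq)
      (trace-injectiveʳ w w′ eq)

  module _ (d : ℕ) (a+d≡b : a + d ≡ b) where

    -- Each step contributes a, and each b-step a further d = b - a; this is the form in which the
    -- theorem gives the transit distance.
    transit≡ : ∀ w → transit w ≡ length w * a + count w * d
    transit≡ []           = refl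
    transit≡ (a-step ∷ w) = trans (cong (_+_ a) (transit≡ w)) (sym (ℕ.+-assoc a (length w * a) _))
    transit≡ (b-step ∷ w) = trans (cong₂ _+_ (sym a+d≡b) (transit≡ w)) (interchange a d (length w * a) (count w * d))
      where
      interchange : ∀ p q r s → p + q + (r + s) ≡ p + r + (q + s)
      interchange = ℕ-Solver.solve-∀

    ∈-circuits⁻ : ∀ {l k c} .{{_ : NonZero l}} → n ∣ l * a + k * d → c ∈ circuits l k →
      IsCircuit c × length c ≡ l × bCount c ≡ k
    ∈-circuits⁻ {l@(suc _)} {k} n∣t c∈ with ∈-map⁻ (uncurry trace) c∈
    ... | (v , w) , vw∈ , refl with ∈-words⁻ l k (proj₂ (∈-cartesianProduct⁻ (allFin n) (words l k) vw∈))
    ... | |w| , #w = trace-circuit⁺ v w (subst NonZero (sym |w|) _)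
        (subst (n ∣_) (sym (trans (transit≡ w) (cong₂ (λ i j → i * a + j * d) |w| #w))) n∣t)
      , trans (length-trace v w) |w| , trans (bCount-trace v w) #w

    trace-of : ∀ {c} → IsCircuit c → ∃[ v ] ∃[ w ] c ≡ trace v w
    trace-of {e ∷ es} (path , _) = _ , _ , path⇒trace e es path

    ∈-circuits⁺ : ∀ {c} → IsCircuit c → c ∈ circuits (length c) (bCount c)
    ∈-circuits⁺ circ with trace-of circ
    ... | v , w , refl = ∈-map⁺ (uncurry trace) (∈-cartesianProduct⁺ (∈-allFin v)
      (subst₂ (λ i j → w ∈ words i j) (sym (length-trace v w)) (sym (bCount-trace v w)) (∈-words⁺ w)))

    circuit⇒∣ : ∀ {c} → IsCircuit c → n ∣ length c * a + bCount c * d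
    circuit⇒∣ circ with trace-of circ
    ... | v , w , refl = subst (n ∣_)
      (trans (transit≡ w) (cong₂ (λ i j → i * a + j * d) (sym (length-trace v w)) (sym (bCount-trace v w))))
      (trace-circuit⁻ v w circ)

-- Orbits under rotation

iterate-injective : ∀ {X : Set} (f : X → X) → (∀ {x y} → f x ≡ f y → x ≡ y) →
  ∀ j {x y} → iterate f x j ≡ iterate f y j → x ≡ y
iterate-injective f f-inj zero    eq = eq
iterate-injective f f-inj (suc j) eq = f-inj (iterate-injective f f-inj j eq)

-- `AllPairs` compares earlier with later entries only; symmetry of `R` covers the other order. It
-- makes pairwise inequivalent representatives index their classes injectively.
AllPairs-lookup-injective : ∀ {A : Set} {R : A → A → Set} → (∀ {x y} → R x y → R y x) →
  ∀ {xs} → AllPairs (λ x y → ¬ R x y) xs → ∀ i j → R (lookup xs i) (lookup xs j) → i ≡ j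
AllPairs-lookup-injective R-sym (_ ∷ _)    zero    zero    _ = refl
AllPairs-lookup-injective R-sym (¬Rx ∷ _)  zero    (suc j) r = contradiction r (All.lookup ¬Rx (∈-lookup j))
AllPairs-lookup-injective R-sym (¬Rx ∷ _)  (suc i) zero    r = contradiction (R-sym r) (All.lookup ¬Rx (∈-lookup i))
AllPairs-lookup-injective R-sym (_ ∷ ¬Rxs) (suc i) (suc j) r = cong suc (AllPairs-lookup-injective R-sym ¬Rxs i j r)

length-concat-const : ∀ {A B : Set} (f : A → List B) m → (∀ x → length (f x) ≡ m) →
  ∀ xs → length (concat (map f xs)) ≡ length xs * m
length-concat-const f m |f| []       = refl
length-concat-const f m |f| (x ∷ xs) =
  trans (List.length-++ (f x)) (cong₂ _+_ (|f| x) (length-concat-const f m |f| xs))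

module Orbits (n a b : ℕ) .{{_ : NonZero n}} where

  open CirculantDigraph n a b
  open Circuits n a b

  σ-injective : ∀ {c c′} → σ c ≡ σ c′ → c ≡ c′
  σ-injective {[]}         {[]}         _  = refl
  σ-injective {[]}         {_ ∷ []}     ()
  σ-injective {[]}         {_ ∷ _ ∷ _}  ()
  σ-injective {_ ∷ []}     {[]}         ()
  σ-injective {_ ∷ _ ∷ _}  {[]}         ()
  σ-injective {_ ∷ es}     {_ ∷ es′}    eq with List.∷ʳ-injective es es′ eq
  ... | refl , refl = refl

  σ^⇒∼ : ∀ c j → c ∼ iterate σ c j
  σ^⇒∼ c zero    = ε
  σ^⇒∼ c (suc j) = fwd refl ◅ σ^⇒∼ (σ c) j

  ∼-sym : ∀ {c c′} → c ∼ c′ → c′ ∼ c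
  ∼-sym = EqClosure.symmetric _

  σ^-reverse : ∀ c → ∃[ j ] iterate σ (σ c) j ≡ c
  σ^-reverse []       = 0 , refl
  σ^-reverse (e ∷ es) = length es , σ^-length (e ∷ es)

  -- A backward step is replaced by rotating the rest of the way round, so forward rotations
  -- suffice.
  ∼⇒σ^ : ∀ {c c′} → c ∼ c′ → ∃[ j ] iterate σ c j ≡ c′
  ∼⇒σ^ ε                = 0 , refl
  ∼⇒σ^ (fwd refl ◅ c∼) with ∼⇒σ^ c∼
  ... | j , eq = suc j , eq
  ∼⇒σ^ {c} {c′} (_◅_ {j = y} (bwd refl) c∼) with ∼⇒σ^ c∼ | σ^-reverse y
  ... | j , eq | i , back = i + j , (begin
    iterate σ (σ y) (i + j)             ≡⟨ iterate-+ σ (σ y) i j ⟩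
    iterate σ (iterate σ (σ y) i) j     ≡⟨ cong (λ x → iterate σ x j) back ⟩
    iterate σ y j                       ≡⟨ eq ⟩
    c′                                  ∎)

  ∼⇒σ^< : ∀ {c c′} .{{_ : NonZero (length c)}} → c ∼ c′ → ∃[ j ] (j < length c × iterate σ c j ≡ c′)
  ∼⇒σ^< {c} c∼c′ with ∼⇒σ^ c∼c′
  ... | j , eq = j % length c , m%n<n j (length c) , trans (sym (iterate-% σ (σ^-length c) j)) eq

  _∼?_ : ∀ c c′ → Dec (c ∼ c′)
  c ∼? c′ = map′ (λ { (j , _ , refl) → σ^⇒∼ c j }) (bounded c)
    -- The bound exceeds the length by one so that j = 0 is available for the empty list too.
    (ℕ.anyUpTo? (λ j → iterate σ c j ≟ c′) (suc (length c)))
    where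
    bounded : ∀ c → c ∼ c′ → ∃[ j ] (j < suc (length c) × iterate σ c j ≡ c′)
    bounded []        c∼c′ with ∼⇒σ^ c∼c′
    ... | j , eq = 0 , s≤s z≤n , trans (sym (σ^-[] j)) eq
      where
      σ^-[] : ∀ j → iterate σ [] j ≡ []
      σ^-[] zero    = refl
      σ^-[] (suc j) = σ^-[] j
    bounded (e ∷ es)  c∼c′ = Product.map₂ (map₁ ℕ.m≤n⇒m≤1+n) (∼⇒σ^< c∼c′)

  ∼-decSetoid : DecSetoid _ _
  ∼-decSetoid = record
    { _≈_ = _∼_
    ; isDecEquivalence = record { isEquivalence = EqClosure.isEquivalence _ ; _≟_ = _∼?_ }
    }

  root : ∀ {c} m p → IsCircuit c → length c ≡ suc m * p → iterate σ c p ≡ c →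
    ∃[ c₀ ] (IsCircuit c₀ × c ≡ c₀ ^^ suc m)
  root {c} m p circ |c| σᵖ≡ = take p c , circuit-^^⁻ m (subst IsCircuit c≡ circ) , c≡
    where
    c≡ : c ≡ take p c ^^ suc m
    c≡ = periodic⇒power m p c |c| σᵖ≡

  -- The length is itself a return time, so the minimal period p divides it; the cofactor `suc m` is
  -- the exponent of the circuit.
  period : ∀ {c} → IsCircuit c →
    ∃[ p ] ∃[ m ] (iterate σ c p ≡ c × (∀ {j} → iterate σ c j ≡ c → p ∣ j) × length c ≡ suc m * p)
  period {c@(_ ∷ _)} circ with minimal-period σ _≟_ (length c) (σ^-length c)
  ... | p , _ , σᵖ≡ , p∣ with p∣ (σ^-length c)
  ... | divides (suc m) |c| = p , m , σᵖ≡ , p∣ , |c|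

  -- A bounded, hence decidable, form of primitivity by which the list of circuits can be filtered.
  Aperiodic : List Bond → Set
  Aperiodic c = ∀ {j} → j < length c → iterate σ c j ≡ c → j ≡ 0

  aperiodic? : Decidable Aperiodic
  aperiodic? c = ℕ.allUpTo? (λ j → (iterate σ c j ≟ c) →-dec (j ℕ.≟ 0)) (length c)

  -- If `c` is a rotation of a proper power of c₀, then, since rotations commute, the length of c₀
  -- is a return time of `c` too. It is positive and below the length of `c`.
  aperiodic⇒primitive : ∀ {c} → Aperiodic c → IsPrimitive c
  aperiodic⇒primitive {c} aper (c₀@(e ∷ es) , suc (suc r) , _ , s≤s (s≤s _) , c∼) =
    contradiction (aper |c₀|<|c| fixed) λ ()
    where
    power : List Bond
    power = c₀ ^^ suc (suc r)
    back : ∃[ j ] iterate σ power j ≡ c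
    back = ∼⇒σ^ (∼-sym c∼)
    |σ^| : ∀ j d → length (iterate σ d j) ≡ length d
    |σ^| zero    d = refl
    |σ^| (suc j) d = trans (|σ^| j (σ d)) (length-σ d)
    |c₀|<|c| : length c₀ < length c
    |c₀|<|c| = subst (length c₀ <_)
      (trans (sym (length-^^ c₀ (suc (suc r))))
        (trans (sym (|σ^| (proj₁ back) power)) (cong length (proj₂ back))))
      (ℕ.m<m+n (length c₀) (s≤s z≤n))
    fixed : iterate σ c (length c₀) ≡ c
    fixed with back
    ... | j , refl = begin
      iterate σ (iterate σ power j) (length c₀)   ≡⟨ iterate-+ σ power j (length c₀) ⟨
      iterate σ power (j + length c₀)             ≡⟨ cong (iterate σ power) (ℕ.+-comm j (length c₀)) ⟩
      iterate σ power (length c₀ + j)             ≡⟨ iterate-+ σ power (length c₀) j ⟩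
      iterate σ (iterate σ power (length c₀)) j   ≡⟨ cong (λ x → iterate σ x j) (σ^-^^ c₀ (suc r)) ⟩
      iterate σ power j                           ∎

  -- An exponent of at least 2 exhibits `c` as a proper power. If the exponent is 1, the length is
  -- the minimal period, and its only multiple below itself is 0.
  primitive⇒aperiodic : ∀ {c} → IsCircuit c → IsPrimitive c → Aperiodic c
  primitive⇒aperiodic {c} circ prim {j} j<|c| σʲ≡ with period circ
  ... | p , suc m , σᵖ≡ , _ , |c| with root (suc m) p circ |c| σᵖ≡
  ...   | c₀ , circ₀ , c≡ = contradiction (c₀ , suc (suc m) , circ₀ , s≤s (s≤s z≤n) , subst (c ∼_) c≡ ε) prim
  primitive⇒aperiodic {c} circ prim {j} j<|c| σʲ≡ | p , zero , _ , p∣ , |c| =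
    small j (subst (_∣ j) (trans (sym (ℕ.*-identityˡ p)) (sym |c|)) (p∣ σʲ≡)) j<|c|
    where
    small : ∀ j → length c ∣ j → j < length c → j ≡ 0
    small zero    _   _     = refl
    small (suc j) |c|∣ j<|c| = contradiction (∣⇒≤ |c|∣) (ℕ.<⇒≱ j<|c|)

  primitive-σ : ∀ {c} → IsPrimitive c → IsPrimitive (σ c)
  primitive-σ prim (c₀ , r , circ₀ , 1<r , σc∼) = prim (c₀ , r , circ₀ , 1<r , fwd refl ◅ σc∼)

  fixed? : ∀ j c → Dec (iterate σ c j ≡ c)
  fixed? j c = iterate σ c j ≟ c

  -- Primitive orbits and their representatives.

  module PrimitiveOrbits (d : ℕ) (a+d≡b : a + d ≡ b) (l k w : ℕ) .{{_ : NonZero l}} (la+kd≡wn : l * a + k * d ≡ w * n) where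

    circs prims reps : List (List Bond)
    circs = circuits l k
    prims = filter aperiodic? circs
    reps  = deduplicate _∼?_ prims

    IsPrim : List Bond → Set
    IsPrim c = IsCircuit c × length c ≡ l × bCount c ≡ k × IsPrimitive c

    ∈-circs⁻ : ∀ {c} → c ∈ circs → IsCircuit c × length c ≡ l × bCount c ≡ k
    ∈-circs⁻ = ∈-circuits⁻ d a+d≡b (divides w la+kd≡wn)

    ∈-prims⁻ : ∀ {c} → c ∈ prims → IsPrim c
    ∈-prims⁻ c∈ with ∈-filter⁻ aperiodic? {xs = circs} c∈
    ... | c∈circs , aper with ∈-circs⁻ c∈circs
    ... | circ , |c| , #c = circ , |c| , #c , aperiodic⇒primitive aper

    ∈-prims⁺ : ∀ {c} → IsPrim c → c ∈ prims
    ∈-prims⁺ (circ , refl , refl , prim) =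
      ∈-filter⁺ aperiodic? (∈-circuits⁺ d a+d≡b circ) (primitive⇒aperiodic circ prim)

    IsPrim-σ : ∀ {c} → IsPrim c → IsPrim (σ c)
    IsPrim-σ {c} (circ , |c| , #c , prim) =
      circuit-σ circ , trans (length-σ c) |c| , trans (bCount-σ c) #c , primitive-σ prim

    reps⊆prims : ∀ {c} → c ∈ reps → IsPrim c
    reps⊆prims = ∈-prims⁻ ∘ ∈-deduplicate⁻ _∼?_ prims

    reps-! : AllPairs (λ r s → ¬ (r ∼ s)) reps
    reps-! = deduplicate-! ∼-decSetoid prims

    reps-cover : ∀ {c} → c ∈ prims → Any (_∼ c) reps
    reps-cover c∈ = Any.deduplicate⁺ _∼?_ (λ y∼x x∼c → y∼x ◅◅ x∼c) (Any.map (λ { refl → ε }) c∈)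

    orbit : List Bond → List (List Bond)
    orbit r = map (iterate σ r) (upTo l)

    ∈-orbit⁻ : ∀ {r c} → c ∈ orbit r → r ∼ c
    ∈-orbit⁻ {r} c∈ with ∈-map⁻ (iterate σ r) c∈
    ... | j , _ , refl = σ^⇒∼ r j

    ∈-orbit⁺ : ∀ {r c} → length r ≡ l → r ∼ c → c ∈ orbit r
    ∈-orbit⁺ {r} refl r∼c with ∼⇒σ^< r∼c
    ... | j , j<l , refl = ∈-map⁺ (iterate σ r) (∈-upTo⁺ j<l)

    -- From σ^i r = σ^j r with i ≤ j < l, injectivity of σ cancels i rotations; the return time j -
    -- i that remains is below l, hence 0.
    orbit-! : ∀ {r} → IsPrim r → Unique (orbit r)
    orbit-! {r} (circ , |r| , _ , prim) = map-! (iterate σ r) injective (Unique.upTo⁺ l)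
      where
      ≤-case : ∀ {i j} → i ≤ j → j < l → iterate σ r i ≡ iterate σ r j → i ≡ j
      ≤-case {i} {j} i≤j j<l eq = ℕ.≤-antisym i≤j (ℕ.m∸n≡0⇒m≤n
        (primitive⇒aperiodic circ prim
          (ℕ.≤-<-trans (ℕ.m∸n≤m j i) (subst (j <_) (sym |r|) j<l))
          (iterate-injective σ σ-injective i (begin
            iterate σ (iterate σ r (j ∸ i)) i ≡⟨ iterate-+ σ r (j ∸ i) i ⟨
            iterate σ r (j ∸ i + i)           ≡⟨ cong (iterate σ r) (ℕ.m∸n+n≡m i≤j) ⟩
            iterate σ r j                     ≡⟨ eq ⟨
            iterate σ r i                     ∎))))
      injective : ∀ {i j} → i ∈ upTo l → j ∈ upTo l → iterate σ r i ≡ iterate σ r j → i ≡ j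
      injective {i} {j} i∈ j∈ eq with ℕ.≤-total i j
      ... | inj₁ i≤j = ≤-case i≤j (∈-upTo⁻ j∈) eq
      ... | inj₂ j≤i = sym (≤-case j≤i (∈-upTo⁻ i∈) (sym eq))

    -- The orbits partition the primitive circuits into blocks of l members, whence the denominator
    -- l of the formula.
    prims↭ : prims ↭ concat (map orbit reps)
    prims↭ = unique∧set⇒↭ (Unique.filter⁺ aperiodic? (circuits-! l k)) orbits-! to from
      where
      orbits-! : Unique (concat (map orbit reps))
      orbits-! = Unique.concat⁺
        (All.map⁺ (All.tabulate (orbit-! ∘ reps⊆prims)))
        (AllPairs.map⁺ (AllPairs.map {S = λ r s → Disjoint (orbit r) (orbit s)} (λ r≁s → disjoint r≁s) reps-!))
        where
        disjoint : ∀ {r s} → ¬ (r ∼ s) → Disjoint (orbit r) (orbit s)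
        disjoint r≁s (c∈r , c∈s) = r≁s (∈-orbit⁻ c∈r ◅◅ ∼-sym (∈-orbit⁻ c∈s))
      to : ∀ {c} → c ∈ prims → c ∈ concat (map orbit reps)
      to c∈ with find (reps-cover c∈)
      ... | r , r∈ , r∼c =
        ∈-concat⁺′ (∈-orbit⁺ (proj₁ (proj₂ (reps⊆prims r∈))) r∼c) (∈-map⁺ orbit r∈)
      from : ∀ {c} → c ∈ concat (map orbit reps) → c ∈ prims
      from c∈ with find (∈-concatMap⁻ orbit {xs = reps} c∈)
      ... | r , r∈ , c∈r with ∈-map⁻ (iterate σ r) c∈r
      ... | j , _ , refl = ∈-prims⁺ (iterate-preserves σ {IsPrim} IsPrim-σ j (reps⊆prims r∈))

    length-prims : length prims ≡ length reps * l
    length-prims = trans (↭.↭-length prims↭)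
      (length-concat-const orbit l (λ r → trans (List.length-map (iterate σ r) (upTo l)) (List.length-upTo l)) reps)

    hasCardinality : HasCardinality (𝒫 l k) (length reps)
    hasCardinality = record
      { to        = to
      ; cong      = λ { refl → ε }
      ; bijective = (λ {i} {j} → AllPairs-lookup-injective ∼-sym reps-! i j) , surjective
      }
      where
      to : Fin (length reps) → PrimitiveCircuit l k
      to i with reps⊆prims (∈-lookup {xs = reps} i)
      ... | circ , |c| , #c , prim = record
        { bonds = lookup reps i ; isCircuit = circ ; length≡ = |c| ; bCount≡ = #c ; isPrimitive = prim }
      surjective : ∀ y → ∃[ i ] (∀ {j} → j ≡ i → PrimitiveCircuit.bonds (to j) ∼ PrimitiveCircuit.bonds y)
      surjective y = Any.index y∈ , λ { refl → Any.lookup-index y∈ }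
        where
        open PrimitiveCircuit y
        y∈ : Any (_∼ bonds) reps
        y∈ = reps-cover (∈-prims⁺ (isCircuit , length≡ , bCount≡ , isPrimitive))

    -- The Möbius sum over the common divisors.

    g : ℕ
    g = gcd (gcd l k) w

    instance
      g≢0 : NonZero g
      g≢0 = ≢-nonZero (λ g≡0 → ≢-nonZero⁻¹ l (gcd[m,n]≡0⇒m≡0 (gcd[m,n]≡0⇒m≡0 {gcd l k} g≡0)))

    g∣l : g ∣ l
    g∣l = ∣-trans (gcd[m,n]∣m (gcd l k) w) (gcd[m,n]∣m l k)

    g∣k : g ∣ k
    g∣k = ∣-trans (gcd[m,n]∣m (gcd l k) w) (gcd[m,n]∣n l k)

    factor : ∀ m x y → m * x * a + m * y * d ≡ m * (x * a + y * d)
    factor m x y = distrib m x y a d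
      where
      distrib : ∀ m x y a d → m * x * a + m * y * d ≡ m * (x * a + y * d)
      distrib = ℕ-Solver.solve-∀

    length-fixed : ∀ {i} → suc i ∣ g →
      length (filter (fixed? (l / suc i)) circs) ≡ n * ((l / suc i) C (k / suc i))
    length-fixed {i} m∣g = begin
      length (filter (fixed? l′) circs)           ≡⟨ ↭.↭-length fixed↭ ⟩
      length (map (_^^ suc i) (circuits l′ k′))   ≡⟨ List.length-map (_^^ suc i) (circuits l′ k′) ⟩
      length (circuits l′ k′)                     ≡⟨ length-circuits l′ k′ ⟩
      n * (l′ C k′)                               ∎
      where
      l′ k′ : ℕ
      l′ = l / suc i
      k′ = k / suc i

      ml′≡l : suc i * l′ ≡ l
      ml′≡l = m*[n/m]≡n (∣-trans m∣g g∣l)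

      mk′≡k : suc i * k′ ≡ k
      mk′≡k = m*[n/m]≡n (∣-trans m∣g g∣k)

      instance
        l′≢0 : NonZero l′
        l′≢0 = ≢-nonZero λ l′≡0 → ≢-nonZero⁻¹ l (trans (sym ml′≡l) (trans (cong (suc i *_) l′≡0) (ℕ.*-zeroʳ i)))

      -- Here m ∣ ω is used: cancelling m in l a + k d = w n leaves a multiple of n, so the shorter
      -- paths close up as well.
      n∣t : n ∣ l′ * a + k′ * d
      n∣t with ∣-trans m∣g (gcd[m,n]∣n (gcd l k) w)
      ... | divides w′ w≡ = divides w′ (ℕ.*-cancelˡ-≡ _ _ (suc i) (begin
        suc i * (l′ * a + k′ * d)             ≡⟨ factor (suc i) l′ k′ ⟨
        suc i * l′ * a + suc i * k′ * d       ≡⟨ cong₂ (λ x y → x * a + y * d) ml′≡l mk′≡k ⟩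
        l * a + k * d                         ≡⟨ la+kd≡wn ⟩
        w * n                                 ≡⟨ cong (_* n) (trans w≡ (ℕ.*-comm w′ (suc i))) ⟩
        suc i * w′ * n                        ≡⟨ ℕ.*-assoc (suc i) w′ n ⟩
        suc i * (w′ * n)                      ∎))

      sound : ∀ {c} → c ∈ circuits l′ k′ → IsCircuit c × length c ≡ l′ × bCount c ≡ k′
      sound = ∈-circuits⁻ d a+d≡b n∣t

      fixed↭ : filter (fixed? l′) circs ↭ map (_^^ suc i) (circuits l′ k′)
      fixed↭ = unique∧set⇒↭ (Unique.filter⁺ (fixed? l′) (circuits-! l k))
        (map-! (_^^ suc i)
          (λ {c} {c′} c∈ c′∈ → ^^-injective i
            (trans (proj₁ (proj₂ (sound c∈))) (sym (proj₁ (proj₂ (sound c′∈))))))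
          (circuits-! l′ k′))
        to from
        where
        to : ∀ {c} → c ∈ filter (fixed? l′) circs → c ∈ map (_^^ suc i) (circuits l′ k′)
        to c∈ with ∈-filter⁻ (fixed? l′) {xs = circs} c∈
        ... | c∈circs , fixed with ∈-circs⁻ c∈circs
        ... | circ , |c| , #c with root i l′ circ (trans |c| (sym ml′≡l)) fixed
        ... | c₀ , circ₀ , refl = ∈-map⁺ (_^^ suc i) (subst₂ (λ x y → c₀ ∈ circuits x y)
          (ℕ.*-cancelˡ-≡ _ _ (suc i) (trans (sym (length-^^ c₀ (suc i))) (trans |c| (sym ml′≡l))))
          (ℕ.*-cancelˡ-≡ _ _ (suc i) (trans (sym (bCount-^^ c₀ (suc i))) (trans #c (sym mk′≡k))))
          (∈-circuits⁺ d a+d≡b circ₀))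
        from : ∀ {c} → c ∈ map (_^^ suc i) (circuits l′ k′) → c ∈ filter (fixed? l′) circs
        from c∈ with ∈-map⁻ (_^^ suc i) c∈
        ... | c₀ , c₀∈ , refl with sound c₀∈
        ... | circ₀ , |c₀| , #c₀ = ∈-filter⁺ (fixed? l′)
          (subst₂ (λ x y → c₀ ^^ suc i ∈ circuits x y)
            (trans (length-^^ c₀ (suc i)) (trans (cong (suc i *_) |c₀|) ml′≡l))
            (trans (bCount-^^ c₀ (suc i)) (trans (cong (suc i *_) #c₀) mk′≡k))
            (∈-circuits⁺ d a+d≡b (circuit-^^⁺ i circ₀)))
          (subst (λ x → iterate σ (c₀ ^^ suc i) x ≡ c₀ ^^ suc i) |c₀| (σ^-^^ c₀ i))

    -- The root is itself a circuit, so its transit distance is q n; comparing (m + 1) q n with w n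
    -- gives the divisibility of w. Hence all divisors of the exponent of a circuit occur among the
    -- divisors of g over which the formula sums.
    exponent∣g : ∀ {c} m p → c ∈ circs → length c ≡ suc m * p → iterate σ c p ≡ c → suc m ∣ g
    exponent∣g m p c∈ |c|≡ σᵖ≡ with ∈-circs⁻ c∈
    ... | circ , |c| , #c with root m p circ |c|≡ σᵖ≡
    ... | c₀ , circ₀ , refl with circuit⇒∣ d a+d≡b circ₀
    ... | divides q t≡ = gcd-greatest (gcd-greatest (divides (length c₀) l≡) (divides (bCount c₀) k≡))
        (divides q (ℕ.*-cancelʳ-≡ w (q * suc m) n (begin
          w * n                                           ≡⟨ la+kd≡wn ⟨
          l * a + k * d                                   ≡⟨ cong₂ (λ x y → x * a + y * d) |c| #c ⟨
          length (c₀ ^^ suc m) * a + bCount (c₀ ^^ suc m) * d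
            ≡⟨ cong₂ (λ x y → x * a + y * d) (length-^^ c₀ (suc m)) (bCount-^^ c₀ (suc m)) ⟩
          suc m * length c₀ * a + suc m * bCount c₀ * d   ≡⟨ factor (suc m) (length c₀) (bCount c₀) ⟩
          suc m * (length c₀ * a + bCount c₀ * d)         ≡⟨ cong (suc m *_) t≡ ⟩
          suc m * (q * n)                                 ≡⟨ ℕ.*-assoc (suc m) q n ⟨
          suc m * q * n                                   ≡⟨ cong (_* n) (ℕ.*-comm (suc m) q) ⟩
          q * suc m * n                                   ∎)))
      where
      l≡ : l ≡ length c₀ * suc m
      l≡ = trans (sym |c|) (trans (length-^^ c₀ (suc m)) (ℕ.*-comm (suc m) _))
      k≡ : k ≡ bCount c₀ * suc m
      k≡ = trans (sym #c) (trans (bCount-^^ c₀ (suc m)) (ℕ.*-comm (suc m) _))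

    μ₁ : ℕ → ℤ
    μ₁ i = μ (suc i)

    fixing : List Bond → List ℕ
    fixing c = filter (λ i → fixed? (l / suc i) c) (divisors g)

    -- With l = (m + 1) p for the minimal period p, a divisor i + 1 of l satisfies p ∣ l / (i + 1)
    -- exactly when it divides m + 1. So `fixing c` lists the divisors of the exponent, and their
    -- Möbius sum detects exponent 1.
    ∑-fixing : ∀ {c} → c ∈ circs → ∑ (fixing c) μ₁ ≡ (if does (aperiodic? c) then 1ℤ else 0ℤ)
    ∑-fixing {c} c∈ with ∈-circs⁻ c∈
    ... | circ , |c| , #c with period circ
    ... | p , m , σᵖ≡ , p∣ , |c|≡ = trans (∑-↭ μ₁ fixing↭) (value m |c|≡)
      where
      l≡ : l ≡ suc m * p
      l≡ = trans (sym |c|) |c|≡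

      rearrange : ∀ x y z → x * y * z ≡ x * z * y
      rearrange = ℕ-Solver.solve-∀

      instance
        p≢0 : NonZero p
        p≢0 = ≢-nonZero λ p≡0 → ≢-nonZero⁻¹ l (trans l≡ (trans (cong (suc m *_) p≡0) (ℕ.*-zeroʳ m)))

      fixing↭ : fixing c ↭ divisors (suc m)
      fixing↭ = unique∧set⇒↭ (Unique.filter⁺ (λ i → fixed? (l / suc i) c) (divisors-! g)) (divisors-! (suc m)) to from
        where
        to : ∀ {i} → i ∈ fixing c → i ∈ divisors (suc m)
        to {i} i∈ with ∈-filter⁻ (λ i → fixed? (l / suc i) c) {xs = divisors g} i∈
        ... | i∈g , fixed with p∣ {l / suc i} fixed
        ... | divides y l/i≡ = ∈-divisors⁺ (divides y (ℕ.*-cancelʳ-≡ (suc m) (y * suc i) p (begin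
          suc m * p             ≡⟨ l≡ ⟨
          l                     ≡⟨ m/n*n≡m (∣-trans (∈-divisors⁻ {g} i∈g) g∣l) ⟨
          l / suc i * suc i     ≡⟨ cong (_* suc i) l/i≡ ⟩
          y * p * suc i         ≡⟨ rearrange y p (suc i) ⟩
          y * suc i * p         ∎)))
        from : ∀ {i} → i ∈ divisors (suc m) → i ∈ fixing c
        from {i} i∈ with ∈-divisors⁻ {suc m} i∈
        ... | divides y m≡ = ∈-filter⁺ (λ i → fixed? (l / suc i) c)
          (∈-divisors⁺ (∣-trans (∈-divisors⁻ {suc m} i∈) (exponent∣g m p c∈ |c|≡ σᵖ≡)))
          (iterate-∣ σ σᵖ≡ (divides y (begin
            l / suc i               ≡⟨ cong (_/ suc i) (trans l≡ (trans (cong (_* p) m≡) (rearrange y (suc i) p))) ⟩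
            y * p * suc i / suc i   ≡⟨ m*n/n≡m (y * p) (suc i) ⟩
            y * p                   ∎)))

      value : ∀ m → length c ≡ suc m * p → ∑ (divisors (suc m)) μ₁ ≡ (if does (aperiodic? c) then 1ℤ else 0ℤ)
      value zero    |c|≡p = cong (if_then 1ℤ else 0ℤ) (sym (dec-true (aperiodic? c) aper))
        where
        aper : Aperiodic c
        aper {zero}  _     _   = refl
        aper {suc j} j<|c| σʲ≡ = contradiction (∣⇒≤ (subst (_∣ suc j) (trans (sym (ℕ.*-identityˡ p)) (sym |c|≡p)) (p∣ σʲ≡))) (ℕ.<⇒≱ j<|c|)
      value (suc m) |c|≡ = trans (∑μ≡0 (suc (suc m)) λ ()) (cong (if_then 1ℤ else 0ℤ) (sym (dec-false (aperiodic? c) ¬aper)))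
        where
        ¬aper : ¬ Aperiodic c
        -- The minimal period is positive and, as the exponent is at least 2, smaller than the
        -- length.
        ¬aper aper = ≢-nonZero⁻¹ p (aper (subst (p <_) (sym |c|≡) (ℕ.m<m+n p (ℕ.≤-trans (>-nonZero⁻¹ p) (ℕ.m≤m+n p _)))) σᵖ≡)

    prims-formula : + length prims ≡
      + n ℤ.* divisorSum g (λ m → μ m ℤ.* + ((l / m) C (k / m)))
    prims-formula = begin
      + length prims
        ≡⟨ ℤ.*-identityˡ (+ length prims) ⟨
      1ℤ ℤ.* + length prims
        ≡⟨ ∑-const prims 1ℤ ⟨
      ∑ prims (λ _ → 1ℤ)
        ≡⟨ ∑-filter aperiodic? circs (λ _ → 1ℤ) ⟩
      ∑ circs (λ c → if does (aperiodic? c) then 1ℤ else 0ℤ)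
        ≡⟨ ∑-cong circs ∑-fixing ⟨
      ∑ circs (λ c → ∑ (fixing c) μ₁)
        -- The pairs of a circuit c and a divisor m with σ^(l/m) c = c are now grouped by m instead
        -- of c.
        ≡⟨ ∑-filter-swap (λ c i → fixed? (l / suc i) c) circs (divisors g) (λ _ → μ₁) ⟩
      ∑ (divisors g) (λ i → ∑ (filter (fixed? (l / suc i)) circs) (λ _ → μ₁ i))
        ≡⟨ ∑-cong (divisors g) (λ {i} i∈ → begin
             ∑ (filter (fixed? (l / suc i)) circs) (λ _ → μ₁ i)
               ≡⟨ ∑-const (filter (fixed? (l / suc i)) circs) (μ₁ i) ⟩
             μ₁ i ℤ.* + length (filter (fixed? (l / suc i)) circs)
               ≡⟨ cong (λ x → μ₁ i ℤ.* + x) (length-fixed (∈-divisors⁻ i∈)) ⟩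
             μ₁ i ℤ.* + (n * ((l / suc i) C (k / suc i)))
               ≡⟨ cong (μ₁ i ℤ.*_) (ℤ.pos-* n _) ⟩
             μ₁ i ℤ.* (+ n ℤ.* + ((l / suc i) C (k / suc i)))
               ≡⟨ rearrange (μ₁ i) (+ n) _ ⟩
             + n ℤ.* (μ₁ i ℤ.* + ((l / suc i) C (k / suc i))) ∎) ⟩
      ∑ (divisors g) (λ i → + n ℤ.* (μ₁ i ℤ.* + ((l / suc i) C (k / suc i))))
        ≡⟨ ∑-*ˡ (divisors g) (+ n) _ ⟩
      + n ℤ.* divisorSum g (λ m → μ m ℤ.* + ((l / m) C (k / m))) ∎
      where
      rearrange : ∀ x y z → x ℤ.* (y ℤ.* z) ≡ y ℤ.* (x ℤ.* z)
      rearrange = ℤ-Solver.solve-∀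

-- Normalised fractions hide their numerators behind a gcd; for unnormalised ones equality is cross
-- multiplication, which is the given integer identity.
/-from-ℤ : ∀ N n l .{{_ : NonZero l}} (s : ℤ) → + (N * l) ≡ + n ℤ.* s →
  (+ N ℚ./ 1) ≡ (+ n ℚ./ l) ℚ.* (s ℚ./ 1)
/-from-ℤ N n l@(suc l-1) s Nl≡ns = ℚ.toℚᵘ-injective (begin′
  ℚ.toℚᵘ (+ N ℚ./ 1)                            ≈⟨ ℚ.toℚᵘ-fromℚᵘ (mkℚᵘ (+ N) 0) ⟩
  mkℚᵘ (+ N) 0                                  ≈⟨ *≡* core ⟩
  mkℚᵘ (+ n) l-1 ℚᵘ.* mkℚᵘ s 0                  ≈⟨ ℚᵘ.*-cong (ℚ.toℚᵘ-fromℚᵘ (mkℚᵘ (+ n) l-1)) (ℚ.toℚᵘ-fromℚᵘ (mkℚᵘ s 0)) ⟨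
  ℚ.toℚᵘ (+ n ℚ./ l) ℚᵘ.* ℚ.toℚᵘ (s ℚ./ 1)      ≈⟨ ℚ.toℚᵘ-homo-* (+ n ℚ./ l) (s ℚ./ 1) ⟨
  ℚ.toℚᵘ ((+ n ℚ./ l) ℚ.* (s ℚ./ 1))            ∎′)
  where
  open ℚᵘ.≃-Reasoning using (step-≈-⟩; step-≈-⟨) renaming (begin_ to begin′_; _∎ to _∎′)
  core : + N ℤ.* + (l * 1) ≡ (+ n ℤ.* s) ℤ.* 1ℤ
  core = begin
    + N ℤ.* + (l * 1)       ≡⟨ cong (λ x → + N ℤ.* + x) (ℕ.*-identityʳ l) ⟩
    + N ℤ.* + l             ≡⟨ ℤ.pos-* N l ⟨
    + (N * l)               ≡⟨ Nl≡ns ⟩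
    + n ℤ.* s               ≡⟨ ℤ.*-identityʳ (+ n ℤ.* s) ⟨
    (+ n ℤ.* s) ℤ.* 1ℤ      ∎

theorem1 : (n a b : ℕ) .{{_ : NonZero n}} → 2 ≤ n → 0 < a → a < b → b < n →
    CirculantDigraph.StronglyConnected n a b →
    (l k : ℕ) .{{_ : NonZero l}} → k ≤ l →
    (ω : ℤ) → + l ℤ.* + a ℤ.+ + k ℤ.* (+ b ℤ.- + a) ≡ ω ℤ.* + n →
    ∃[ N ] (HasCardinality (CirculantDigraph.𝒫 n a b l k) N ×
    (+ N ℚ./ 1) ≡
    (+ n ℚ./ l) ℚ.*
    (divisorSum (gcd (gcd l k) ∣ ω ∣) (λ m → μ m ℤ.* + ((l / m) C (k / m))) ℚ./ 1))
theorem1 n a b _ _ a<b _ _ l k _ ω eq =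
  length reps , hasCardinality ,
  /-from-ℤ (length reps) n l _ (trans (cong +_ (sym length-prims)) prims-formula)
  where
  d : ℕ
  d = b ∸ a
  a+d≡b : a + d ≡ b
  a+d≡b = ℕ.m+[n∸m]≡n (ℕ.<⇒≤ a<b)
  -- Since a < b the left side of the hypothesis is a natural number, so absolute values move the
  -- equation to ℕ, with ∣ ω ∣ as in the gcd.
  eqℕ : l * a + k * d ≡ ∣ ω ∣ * n
  eqℕ = begin
    l * a + k * d                                        ≡⟨⟩
    ∣ + (l * a + k * d) ∣                                ≡⟨ cong ∣_∣ (ℤ.pos-+ (l * a) (k * d)) ⟩
    ∣ + (l * a) ℤ.+ + (k * d) ∣                          ≡⟨ cong₂ (λ x y → ∣ x ℤ.+ y ∣) (ℤ.pos-* l a) (ℤ.pos-* k d) ⟩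
    ∣ + l ℤ.* + a ℤ.+ + k ℤ.* + d ∣                      ≡⟨ cong (λ x → ∣ + l ℤ.* + a ℤ.+ + k ℤ.* x ∣)
                                                              (trans (sym (ℤ.⊖-≥ (ℕ.<⇒≤ a<b))) (sym (ℤ.m-n≡m⊖n b a))) ⟩
    ∣ + l ℤ.* + a ℤ.+ + k ℤ.* (+ b ℤ.- + a) ∣            ≡⟨ cong ∣_∣ eq ⟩
    ∣ ω ℤ.* + n ∣                                        ≡⟨ ℤ.abs-* ω (+ n) ⟩
    ∣ ω ∣ * n                                            ∎
  open Orbits.PrimitiveOrbits n a b d a+d≡b l k ∣ ω ∣ eqℕ
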